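{- Let $R$ be a principal ideal domain and let $I=gR\subsetneq R$ be a proper, non-prime ideal such that $Q:=R/I$ is finite. Suppose that $g=u\cdot p_1p_2$ with $u$ a unit and $p_1,p_2$ non-associated prime elements. Then $\Gamma_{E'}(Q)$ is a clique, and in particular $\mathrm{box}(\Gamma_{E'}(Q))=0$.
   Context: Rings are commutative and non-zero with $1$. For a ring $Q$, $Z(Q)$ is the set of $r\in Q$ for which there is $s\in Q\setminus\{0\}$ with $rs=0$. The zero divisor graph $\Gamma(Q)$ has vertex set $Z(Q)\setminus\{0\}$; two distinct vertices $r,s$ are adjacent iff $rs=0$. For a graph $G=(V,E)$ with neighbourhoods $N(\cdot)$, define $u\sim' v$ if $N(u)\setminus\{u,v\}=N(v)\setminus\{u,v\}$; this is an equivalence relation, with classes $[v]'$. The graph $G_{E'}$ has vertex set $\{[v]'\colon v\in V\}$ and edge set $\{\{[u]',[v]'\}\colon [u]'\ne[v]' \text{ and } \{u,v\}\in E\}$. $\Gamma_{E'}(Q)$ denotes $G_{E'}$ for $G=\Gamma(Q)$. A clique is a complete graph (a single vertex counts). The boxicity $\mathrm{box}(H)$ of a finite simple graph $H$ is the minimum integer $d\ge 0$ such that there exist $d$ interval graphs $I_1,\dots,I_d$ on $V(H)$ with $E(H)=\bigcap_{j=1}^d E(I_j)$; the empty intersection ($d=0$) is the set of all pairs of vertices. -}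

module Defs where

open import Algebra.Bundles using (CommutativeRing; Semiring)
open import Data.Fin.Base using (Fin)
open import Data.Nat.Base as ℕ using (ℕ)
open import Data.Product.Base using (Σ; ∃; ∃₂; _×_; _,_; proj₁; proj₂)
open import Data.Rational.Base as ℚ using (ℚ)
open import Data.Sum.Base using (_⊎_)
open import Function.Bundles using (Inverse; _⇔_)
open import Function.Construct.Composition using (_⇔-∘_)
open import Function.Construct.Identity using (⇔-id)
open import Function.Construct.Symmetry using (⇔-sym)
open import Level using (Level; 0ℓ; _⊔_) renaming (suc to lsuc)
open import Relation.Binary.Bundles using (Setoid)
open import Relation.Binary.Core using (Rel)
open import Relation.Binary.Definitions using (Symmetric; _Respects_; _Respects₂_)
import Relation.Binary.PropositionalEquality as ≡
import Relation.Binary.Reasoning.Setoid as SetoidReasoning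
open import Relation.Nullary.Negation.Core using (¬_)
open import Relation.Unary using (Pred; _∈_; _∉_)
import Algebra.Definitions
import Algebra.Definitions.RawMagma
import Algebra.Definitions.RawSemiring
import Algebra.Properties.AbelianGroup
import Algebra.Properties.CommutativeSemigroup
import Algebra.Properties.Ring
import Algebra.Properties.Semiring.Divisibility

private
  variable
    c ℓ e i : Level

Finite : Setoid c ℓ → Set (c ⊔ ℓ)
Finite S = ∃ λ n → Inverse S (≡.setoid (Fin n))

------------------------------------------------------------------------
-- Rings and ideals

module _ (R : CommutativeRing c ℓ) where
  open CommutativeRing R
  open Algebra.Definitions.RawSemiring (Semiring.rawSemiring semiring) using (_∣_; Prime)
  open Algebra.Definitions.RawMagma *-rawMagma using (_,_)
  open Algebra.Definitions _≈_ using (Invertible)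

  IsUnit : Pred Carrier (c ⊔ ℓ)
  IsUnit = Invertible 1# _*_

  IsPrimeElement : Pred Carrier (c ⊔ ℓ)
  IsPrimeElement = Prime

  Associated : Rel Carrier (c ⊔ ℓ)
  Associated x y = ∃ λ u → IsUnit u × x ≈ u * y

  -- Closure under negation follows from absorption, with r = - 1#.
  record Ideal i : Set (c ⊔ ℓ ⊔ lsuc i) where
    field
      member   : Pred Carrier i
      resp     : member Respects _≈_
      0∈       : 0# ∈ member
      +-closed : ∀ {x y} → x ∈ member → y ∈ member → x + y ∈ member
      absorbs  : ∀ r {x} → x ∈ member → r * x ∈ member

  record IsProper (I : Ideal i) : Set i where
    open Ideal I
    field
      1∉I : 1# ∉ member

  record IsPrimeIdeal (I : Ideal i) : Set (c ⊔ i) where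
    open Ideal I
    field
      proper : IsProper I
      prime  : ∀ {x y} → x * y ∈ member → x ∈ member ⊎ y ∈ member

  IsPrincipal : Ideal i → Set (c ⊔ ℓ ⊔ i)
  IsPrincipal I = ∃ λ g → ∀ x → x ∈ Ideal.member I ⇔ g ∣ x

  ⟨_⟩ : Carrier → Ideal (c ⊔ ℓ)
  ⟨ g ⟩ = record
    { member   = g ∣_
    ; resp     = ∣ʳ-respʳ-≈
    ; 0∈       = g ∣0
    ; +-closed = λ (q , qg≈x) (r , rg≈y) →
        q + r , trans (distribʳ g q r) (+-cong qg≈x rg≈y)
    ; absorbs  = λ r → x∣ʳy⇒x∣ʳzy r
    }
    where
    open Algebra.Properties.Semiring.Divisibility semiring
      using (∣ʳ-respʳ-≈; _∣0; x∣ʳy⇒x∣ʳzy)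

  record IsIntegralDomain : Set (c ⊔ ℓ) where
    field
      1≉0            : ¬ 1# ≈ 0#
      noZeroDivisors : ∀ {x y} → x * y ≈ 0# → x ≈ 0# ⊎ y ≈ 0#

  -- c ⊔ ℓ is the universe level in which principal ideals live.
  record IsPrincipalIdealDomain : Set (lsuc (c ⊔ ℓ)) where
    field
      isIntegralDomain : IsIntegralDomain
      principal        : (I : Ideal (c ⊔ ℓ)) → IsPrincipal I

-- The quotient ring has the same carrier, with x ≈ y meaning x - y ∈ I.
module _ (R : CommutativeRing c ℓ) (I : Ideal R i) where
  open CommutativeRing R
  open Ideal I
  open Algebra.Properties.Ring ring using (-1*x≈-x; -‿distribˡ-*; -‿distribʳ-*)
  open Algebra.Properties.AbelianGroup +-abelianGroup using (⁻¹-∙-comm; ⁻¹-involutive; //-rightDividesˡ)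
  open Algebra.Properties.CommutativeSemigroup +-commutativeSemigroup using (interchange)
  open SetoidReasoning setoid

  private
    infix 4 _~_
    _~_ : Rel Carrier i
    x ~ y = x - y ∈ member

    neg : ∀ {x} → x ∈ member → - x ∈ member
    neg {x} p = resp (-1*x≈-x x) (absorbs (- 1#) p)

    ≈⇒~ : ∀ {x y} → x ≈ y → x ~ y
    ≈⇒~ {x} {y} p = resp (sym (trans (+-congʳ p) (-‿inverseʳ y))) 0∈

    flip-eq : ∀ x y → - (x - y) ≈ y - x
    flip-eq x y = begin
      - (x - y)     ≈⟨ ⁻¹-∙-comm x (- y) ⟨
      - x + - - y   ≈⟨ +-congˡ (⁻¹-involutive y) ⟩
      - x + y       ≈⟨ +-comm (- x) y ⟩
      y - x         ∎

    telescope : ∀ x y z → (x - y) + (y - z) ≈ x - z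
    telescope x y z = begin
      (x - y) + (y - z)    ≈⟨ +-assoc (x - y) y (- z) ⟨
      ((x - y) + y) - z    ≈⟨ +-congʳ (//-rightDividesˡ y x) ⟩
      x - z                ∎

    ~-sym : ∀ {x y} → x ~ y → y ~ x
    ~-sym {x} {y} p = resp (flip-eq x y) (neg p)

    ~-trans : ∀ {x y z} → x ~ y → y ~ z → x ~ z
    ~-trans {x} {y} {z} p q = resp (telescope x y z) (+-closed p q)

    ~-+-cong : ∀ {x x′ y y′} → x ~ x′ → y ~ y′ → x + y ~ x′ + y′
    ~-+-cong {x} {x′} {y} {y′} p q = resp
      (trans (interchange x (- x′) y (- y′)) (+-congˡ (⁻¹-∙-comm x′ y′)))
      (+-closed p q)

    ~-neg-cong : ∀ {x y} → x ~ y → - x ~ - y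
    ~-neg-cong {x} {y} p = resp (sym (⁻¹-∙-comm x (- y))) (neg p)

    ~-*-congˡ : ∀ x {y y′} → y ~ y′ → x * y ~ x * y′
    ~-*-congˡ x {y} {y′} q = resp
      (trans (distribˡ x y (- y′)) (+-congˡ (sym (-‿distribʳ-* x y′))))
      (absorbs x q)

    ~-*-cong : ∀ {x x′ y y′} → x ~ x′ → y ~ y′ → x * y ~ x′ * y′
    ~-*-cong {x} {x′} {y} {y′} p q =
      ~-trans (~-*-congˡ x q)
        (~-trans (≈⇒~ (*-comm x y′))
          (~-trans (~-*-congˡ y′ p) (≈⇒~ (*-comm y′ x′))))

  infixl 7 _/_
  _/_ : CommutativeRing c i
  _/_ = record
    { Carrier = Carrier
    ; _≈_     = _~_
    ; _+_     = _+_
    ; _*_     = _*_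
    ; -_      = -_
    ; 0#      = 0#
    ; 1#      = 1#
    ; isCommutativeRing = record
      { isRing = record
        { +-isAbelianGroup = record
          { isGroup = record
            { isMonoid = record
              { isSemigroup = record
                { isMagma = record
                  { isEquivalence = record
                    { refl = ≈⇒~ refl ; sym = ~-sym ; trans = ~-trans }
                  ; ∙-cong = ~-+-cong
                  }
                ; assoc = λ x y z → ≈⇒~ (+-assoc x y z)
                }
              ; identity = (λ x → ≈⇒~ (+-identityˡ x)) , (λ x → ≈⇒~ (+-identityʳ x))
              }
            ; inverse = (λ x → ≈⇒~ (-‿inverseˡ x)) , (λ x → ≈⇒~ (-‿inverseʳ x))
            ; ⁻¹-cong = ~-neg-cong
            }
          ; comm = λ x y → ≈⇒~ (+-comm x y)
          }
        ; *-cong     = ~-*-cong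
        ; *-assoc    = λ x y z → ≈⇒~ (*-assoc x y z)
        ; *-identity = (λ x → ≈⇒~ (*-identityˡ x)) , (λ x → ≈⇒~ (*-identityʳ x))
        ; distrib    = (λ x y z → ≈⇒~ (distribˡ x y z)) , (λ x y z → ≈⇒~ (distribʳ x y z))
        }
      ; *-comm = λ x y → ≈⇒~ (*-comm x y)
      }
    }

------------------------------------------------------------------------
-- Simple graphs

record SimpleGraph (V : Setoid c ℓ) e : Set (c ⊔ ℓ ⊔ lsuc e) where
  open Setoid V
  field
    Adj        : Rel Carrier e
    Adj-resp   : Adj Respects₂ _≈_
    Adj-sym    : Symmetric Adj
    Adj-irrefl : ∀ {u v} → Adj u v → ¬ u ≈ v

module _ {V : Setoid c ℓ} (G : SimpleGraph V e) where
  open Setoid V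
  open SimpleGraph G

  record IsClique : Set (c ⊔ ℓ ⊔ e) where
    field
      nonempty : Carrier
      complete : ∀ u v → ¬ u ≈ v → Adj u v

  -- w ∈ N(u) ∖ {u , v} iff w ∈ N(v) ∖ {u , v}
  infix 4 _∼′_
  _∼′_ : Rel Carrier (c ⊔ ℓ ⊔ e)
  u ∼′ v = ∀ w → (Adj u w × ¬ w ≈ u × ¬ w ≈ v) ⇔ (Adj v w × ¬ w ≈ u × ¬ w ≈ v)

  [_]′ : Carrier → Pred Carrier (c ⊔ ℓ ⊔ e)
  [ v ]′ w = w ∼′ v

  -- The vertex [ v ]′ is represented by v, and two vertices are equal when
  -- they have the same elements.  This needs no transitivity of _∼′_, whose
  -- proof splits on whether vertices are equal.
  classes : Setoid c (c ⊔ ℓ ⊔ e)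
  classes = record
    { Carrier = Carrier
    ; _≈_     = λ u v → ∀ w → w ∈ [ u ]′ ⇔ w ∈ [ v ]′
    ; isEquivalence = record
      { refl  = λ w → ⇔-id _
      ; sym   = λ p w → ⇔-sym (p w)
      ; trans = λ p q w → q w ⇔-∘ p w
      }
    }

  -- {[ x ]′ , [ y ]′} is an edge when it equals {[ u ]′ , [ v ]′} for some
  -- edge {u , v} of G with [ u ]′ ≠ [ v ]′.
  quotientGraph : SimpleGraph classes (c ⊔ ℓ ⊔ e)
  quotientGraph = record
    { Adj = λ x y → ¬ x ≐ y × ∃₂ λ u v → u ≐ x × v ≐ y × Adj u v
    ; Adj-resp =
        (λ y≐z (x≢y , u , v , u≐x , v≐y , a) →
          (λ x≐z → x≢y (C.trans x≐z (C.sym y≐z))) , u , v , u≐x , C.trans v≐y y≐z , a)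
      , (λ y≐z (y≢x , u , v , u≐y , v≐x , a) →
          (λ z≐x → y≢x (C.trans y≐z z≐x)) , u , v , C.trans u≐y y≐z , v≐x , a)
    ; Adj-sym = λ (x≢y , u , v , u≐x , v≐y , a) →
        (λ y≐x → x≢y (C.sym y≐x)) , v , u , v≐y , u≐x , Adj-sym a
    ; Adj-irrefl = proj₁
    }
    where
    module C = Setoid classes
    open C using () renaming (_≈_ to _≐_)

------------------------------------------------------------------------
-- The zero divisor graph

module _ (Q : CommutativeRing c ℓ) where
  open CommutativeRing Q

  Z : Pred Carrier (c ⊔ ℓ)
  Z r = ∃ λ s → ¬ s ≈ 0# × r * s ≈ 0#

  nonzeroZeroDivisors : Setoid (c ⊔ ℓ) ℓ
  nonzeroZeroDivisors = record
    { Carrier = ∃ λ r → r ∈ Z × ¬ r ≈ 0#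
    ; _≈_     = λ u v → proj₁ u ≈ proj₁ v
    ; isEquivalence = record { refl = refl ; sym = sym ; trans = trans }
    }

  Γ : SimpleGraph nonzeroZeroDivisors ℓ
  Γ = record
    { Adj = λ (r , _) (s , _) → ¬ r ≈ s × r * s ≈ 0#
    ; Adj-resp =
        (λ s≈t (r≉s , rs≈0) →
          (λ r≈t → r≉s (trans r≈t (sym s≈t))) , trans (*-congˡ (sym s≈t)) rs≈0)
      , (λ s≈t (s≉r , sr≈0) →
          (λ t≈r → s≉r (trans s≈t t≈r)) , trans (*-congʳ (sym s≈t)) sr≈0)
    ; Adj-sym = λ (r≉s , rs≈0) → (λ s≈r → r≉s (sym s≈r)) , trans (*-comm _ _) rs≈0
    ; Adj-irrefl = proj₁
    }

  Γ-E′ : SimpleGraph (classes Γ) (c ⊔ ℓ)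
  Γ-E′ = quotientGraph Γ

------------------------------------------------------------------------
-- Boxicity

-- Dedekind cuts
record ℝ : Set₁ where
  field
    lower upper     : Pred ℚ 0ℓ
    lower-inhabited : ∃ lower
    upper-inhabited : ∃ upper
    lower-rounded   : ∀ q → lower q ⇔ (∃ λ r → q ℚ.< r × lower r)
    upper-rounded   : ∀ q → upper q ⇔ (∃ λ r → r ℚ.< q × upper r)
    disjoint        : ∀ q → ¬ (lower q × upper q)
    located         : ∀ {q r} → q ℚ.< r → lower q ⊎ upper r

infix 4 _≤ℝ_ _≈ℝ_
_≤ℝ_ : Rel ℝ 0ℓ
x ≤ℝ y = ∀ q → ℝ.lower x q → ℝ.lower y q

_≈ℝ_ : Rel ℝ 0ℓ
x ≈ℝ y = x ≤ℝ y × y ≤ℝ x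

-- Nonempty closed intervals.  For finite graphs, allowing other kinds of
-- nonempty intervals gives the same intersection graphs.
record Interval : Set₁ where
  field
    left right : ℝ
    left≤right : left ≤ℝ right

infix 4 _∈ᴵ_
_∈ᴵ_ : ℝ → Interval → Set
x ∈ᴵ J = Interval.left J ≤ℝ x × x ≤ℝ Interval.right J

Intersect : Rel Interval (lsuc 0ℓ)
Intersect J K = ∃ λ x → x ∈ᴵ J × x ∈ᴵ K

record IntervalAssignment (V : Setoid c ℓ) : Set (c ⊔ ℓ ⊔ lsuc 0ℓ) where
  open Setoid V
  field
    interval   : Carrier → Interval
    left-cong  : ∀ {u v} → u ≈ v → Interval.left  (interval u) ≈ℝ Interval.left  (interval v)
    right-cong : ∀ {u v} → u ≈ v → Interval.right (interval u) ≈ℝ Interval.right (interval v)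

-- The interval graphs on V are, by definition, the graphs of this form.
intervalGraph : {V : Setoid c ℓ} → IntervalAssignment V → SimpleGraph V (ℓ ⊔ lsuc 0ℓ)
intervalGraph {V = V} A = record
  { Adj = λ u v → ¬ u ≈ v × Intersect (interval u) (interval v)
  ; Adj-resp =
      (λ v≈w (u≉v , x , x∈u , x∈v) →
        (λ u≈w → u≉v (trans u≈w (sym v≈w))) , x , x∈u , move x v≈w x∈v)
    , (λ v≈w (v≉u , x , x∈v , x∈u) →
        (λ w≈u → v≉u (trans v≈w w≈u)) , x , move x v≈w x∈v , x∈u)
  ; Adj-sym = λ (u≉v , x , x∈u , x∈v) → (λ v≈u → u≉v (sym v≈u)) , x , x∈v , x∈u
  ; Adj-irrefl = proj₁
  }
  where
  open Setoid V
  open IntervalAssignment A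
  move : ∀ x {u v} → u ≈ v → x ∈ᴵ interval u → x ∈ᴵ interval v
  move _ u≈v (l≤x , x≤r) =
      (λ q p → l≤x q (proj₂ (left-cong u≈v) q p))
    , (λ q p → proj₁ (right-cong u≈v) q (x≤r q p))

module _ {V : Setoid c ℓ} (H : SimpleGraph V e) where
  open Setoid V
  open SimpleGraph

  -- Edges are pairs of distinct vertices, so the clause ¬ u ≈ v only
  -- matters for d = 0, where the empty intersection is the set of all pairs.
  IsIntersectionOfIntervalGraphs : ℕ → Set (c ⊔ ℓ ⊔ e ⊔ lsuc 0ℓ)
  IsIntersectionOfIntervalGraphs d =
    Σ (Fin d → IntervalAssignment V) λ I →
      ∀ u v → Adj H u v ⇔ (¬ u ≈ v × (∀ j → Adj (intervalGraph (I j)) u v))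

  -- IsBoxicity d says box(H) = d.
  record IsBoxicity (d : ℕ) : Set (c ⊔ ℓ ⊔ e ⊔ lsuc 0ℓ) where
    field
      attained : IsIntersectionOfIntervalGraphs d
      minimal  : ∀ {d′} → IsIntersectionOfIntervalGraphs d′ → d ℕ.≤ d′

{-# OPTIONS --safe #-}

-- A nonzero zero divisor of Q = R / (p₁p₂) is divisible by exactly one of p₁
-- and p₂.  Two vertices divisible by the same pⱼ have the same neighbours
-- apart from themselves, and two vertices divisible by different pⱼ have
-- product zero, so distinct classes of _∼′_ are adjacent.  Finiteness of Q
-- gives decidable equality, which makes _∼′_ transitive constructively.

module Submission where

open import Defs
open import Algebra.Bundles using (CommutativeRing; Semiring)
import Data.Fin.Properties as Fin
open import Data.Nat.Base using (z≤n)
open import Data.Product.Base using (_×_; _,_; proj₁; proj₂)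
open import Data.Sum.Base using (_⊎_; inj₁; inj₂; [_,_])
open import Function.Base using (_∘_; id)
open import Function.Bundles using (Equivalence; mk⇔)
open import Function.Properties.Inverse using (Inverse⇒Injection)
open import Level using (Level)
open import Relation.Binary.Bundles using (Setoid)
open import Relation.Binary.Definitions using (Decidable)
open import Relation.Nullary.Decidable using (yes; no; via-injection)
open import Relation.Nullary.Negation.Core using (¬_; contradiction)
import Algebra.Definitions
import Algebra.Definitions.RawSemiring
import Algebra.Properties.AbelianGroup
import Algebra.Properties.CommutativeSemigroup
import Algebra.Properties.CommutativeSemigroup.Divisibility
import Algebra.Properties.Ring
import Algebra.Properties.Semiring.Divisibility
import Relation.Binary.Reasoning.Setoid as SetoidReasoning

private
  variable
    c ℓ e : Level

finite⇒decidable : (S : Setoid c ℓ) → Finite S → Decidable (Setoid._≈_ S)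
finite⇒decidable S (_ , S↔Fin) = via-injection (Inverse⇒Injection S↔Fin) Fin._≟_

-- Twin vertices, quotient cliques and boxicity.

module _ {V : Setoid c ℓ} (G : SimpleGraph V e) where
  open Setoid V
  open SimpleGraph G

  private
    infix 4 _∼_
    _∼_ = _∼′_ G

  -- The side condition `¬ w ≈ u` in `_∼′_` comes for free from irreflexivity, which leaves
  -- `¬ w ≈ v` as the only proviso when moving an edge.
  ∼′-transfer : ∀ {u v w} → u ∼ v → Adj u w → ¬ w ≈ v → Adj v w
  ∼′-transfer u∼v uw w≉v =
    proj₁ (Equivalence.to (u∼v _) (uw , (λ w≈u → Adj-irrefl uw (sym w≈u)) , w≉v))

  ∼′-intro : ∀ {u v} →
    (∀ w → Adj u w → ¬ w ≈ v → Adj v w) →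
    (∀ w → Adj v w → ¬ w ≈ u → Adj u w) → u ∼ v
  ∼′-intro u⇒v v⇒u w = mk⇔
    (λ (uw , w≉u , w≉v) → u⇒v w uw w≉v , w≉u , w≉v)
    (λ (vw , w≉u , w≉v) → v⇒u w vw w≉u , w≉u , w≉v)

  ∼′-reflexive : ∀ {u v} → u ≈ v → u ∼ v
  ∼′-reflexive u≈v = ∼′-intro
    (λ _ uw _ → proj₂ Adj-resp u≈v uw)
    (λ _ vw _ → proj₂ Adj-resp (sym u≈v) vw)

  ∼′-sym : ∀ {u v} → u ∼ v → v ∼ u
  ∼′-sym u∼v = ∼′-intro
    (λ w vw w≉u → proj₁ (Equivalence.from (u∼v w)
      (vw , w≉u , λ w≈v → Adj-irrefl vw (sym w≈v))))
    (λ w → ∼′-transfer u∼v)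

  module _ (_≟_ : Decidable _≈_) where

    ∼′-trans-transfer : ∀ {u v w} → u ∼ v → v ∼ w →
                        ∀ x → Adj u x → ¬ x ≈ w → Adj w x
    ∼′-trans-transfer {u} {v} {w} u∼v v∼w x ux x≉w with x ≟ v | u ≟ w
    ... | no x≉v  | _       = ∼′-transfer v∼w (∼′-transfer u∼v ux x≉v) x≉w
    ... | yes _   | yes u≈w = proj₂ Adj-resp u≈w ux
    -- Here u, v, w are distinct and uv is an edge; transferring it to wu along
    -- v ∼ w and then to vw along u ∼ v gives the edge wx.
    ... | yes x≈v | no u≉w  = proj₁ Adj-resp (sym x≈v) (Adj-sym vw)
      where
      wu : Adj w u
      wu = ∼′-transfer v∼w (Adj-sym (proj₁ Adj-resp x≈v ux)) u≉w

      vw : Adj v w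
      vw = ∼′-transfer u∼v (Adj-sym wu) (λ w≈v → x≉w (trans x≈v (sym w≈v)))

    ∼′-trans : ∀ {u v w} → u ∼ v → v ∼ w → u ∼ w
    ∼′-trans u∼v v∼w = ∼′-intro
      (∼′-trans-transfer u∼v v∼w)
      (∼′-trans-transfer (∼′-sym v∼w) (∼′-sym u∼v))

    -- Equality in `classes` compares all elements of two classes, so transitivity, and with it
    -- decidable equality, enters here.
    ∼′⇒classes-≈ : ∀ {u v} → u ∼ v → Setoid._≈_ (classes G) u v
    ∼′⇒classes-≈ u∼v w = mk⇔
      (λ w∼u → ∼′-trans w∼u u∼v)
      (λ w∼v → ∼′-trans w∼v (∼′-sym u∼v))

    quotientGraph-isClique : Carrier → (∀ u v → ¬ u ≈ v → u ∼ v ⊎ Adj u v) →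
                             IsClique (quotientGraph G)
    quotientGraph-isClique v₀ ∼⊎Adj = record
      { nonempty = v₀
      ; complete = λ u v u≢v →
          u≢v , u , v , C.refl {u} , C.refl {v} ,
          [ (λ u∼v → contradiction (∼′⇒classes-≈ u∼v) u≢v) , id ]
            -- Equal vertices would be twins and so have equal classes; hence distinct classes have
            -- distinct representatives.
            (∼⊎Adj u v (u≢v ∘ ∼′⇒classes-≈ ∘ ∼′-reflexive))
      }
      where module C = Setoid (classes G)

-- The empty intersection consists of all pairs of distinct vertices, which is the edge set of a
-- clique.
clique⇒boxicity≡0 : {V : Setoid c ℓ} (H : SimpleGraph V e) → IsClique H → IsBoxicity H 0
clique⇒boxicity≡0 H isClique = record
  { attained = (λ ()) , λ u v → mk⇔
      (λ uv → SimpleGraph.Adj-irrefl H uv , λ ())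
      (λ (u≉v , _) → IsClique.complete isClique u v u≉v)
  ; minimal  = λ _ → z≤n
  }

-- Divisibility by primes.

module _ (R : CommutativeRing c ℓ) (isDomain : IsIntegralDomain R) where
  open CommutativeRing R
  open IsIntegralDomain isDomain
  open Algebra.Definitions _≈_ using (AlmostRightCancellative)
  open Algebra.Definitions.RawSemiring (Semiring.rawSemiring semiring) using (Prime; mkPrime)
  open Algebra.Properties.Semiring.Divisibility semiring using (_∣_; _∤_; _,_)
  open Algebra.Properties.CommutativeSemigroup *-commutativeSemigroup using (xy∙z≈xz∙y)
  open Algebra.Properties.AbelianGroup +-abelianGroup using (x∙y⁻¹≈ε⇒x≈y; x≈y⇒x∙y⁻¹≈ε)
  open Algebra.Properties.Ring ring using ([y-z]x≈yx-zx)
  open SetoidReasoning setoid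

  *-almostCancelʳ : AlmostRightCancellative 0# _*_
  *-almostCancelʳ x y z x≉0 yx≈zx =
    [ x∙y⁻¹≈ε⇒x≈y y z , (λ x≈0 → contradiction x≈0 x≉0) ]
      (noZeroDivisors (trans ([y-z]x≈yx-zx x y z) (x≈y⇒x∙y⁻¹≈ε yx≈zx)))

  *-selfˡ⇒1 : ∀ {x y} → ¬ x ≈ 0# → y * x ≈ x → y ≈ 1#
  *-selfˡ⇒1 {x} {y} x≉0 yx≈x =
    *-almostCancelʳ x y 1# x≉0 (trans yx≈x (sym (*-identityˡ x)))

  -- Write `q = k * p`. As a prime, `q` divides `k` or `p`; if `k = m * q`, cancelling `q` gives
  -- `m * p = 1`, so `p` would be a unit.
  prime-∣-sym : ∀ {p q} → Prime p → Prime q → p ∣ q → q ∣ p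
  prime-∣-sym {p} {q} (mkPrime _ p∤1 _) (mkPrime q≉0 _ split) (k , kp≈q)
    with split (1# , trans (*-identityˡ q) (sym kp≈q))
  ... | inj₂ q∣p        = q∣p
  ... | inj₁ (m , mq≈k) = contradiction (m , *-selfˡ⇒1 q≉0 (begin
    m * p * q  ≈⟨ xy∙z≈xz∙y m p q ⟩
    m * q * p  ≈⟨ *-congʳ mq≈k ⟩
    k * p      ≈⟨ kp≈q ⟩
    q          ∎)) p∤1

  -- The two cofactors satisfy `m * k * x = x`, so cancelling `x` makes them mutually inverse.
  mutual-∣⇒associated : ∀ {x y} → ¬ x ≈ 0# → x ∣ y → y ∣ x → Associated R x y
  mutual-∣⇒associated {x} {y} x≉0 (k , kx≈y) (m , my≈x) =
    m , (k , trans (*-comm k m) mk≈1 , mk≈1) , sym my≈x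
    where
    mk≈1 : m * k ≈ 1#
    mk≈1 = *-selfˡ⇒1 x≉0 (begin
      m * k * x    ≈⟨ *-assoc m k x ⟩
      m * (k * x)  ≈⟨ *-congˡ kx≈y ⟩
      m * y        ≈⟨ my≈x ⟩
      x            ∎)

  nonAssociated⇒∤ : ∀ {p q} → Prime p → Prime q → ¬ Associated R p q → p ∤ q × q ∤ p
  nonAssociated⇒∤ pp pq p≁q =
      (λ p∣q → p≁q (mutual-∣⇒associated (Prime.p≉0 pp) p∣q (prime-∣-sym pp pq p∣q)))
    , (λ q∣p → p≁q (mutual-∣⇒associated (Prime.p≉0 pp) (prime-∣-sym pq pp q∣p) q∣p))

module _ (R : CommutativeRing c ℓ) where
  open CommutativeRing R
  open Algebra.Definitions.RawSemiring (Semiring.rawSemiring semiring) using (Prime)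
  open Algebra.Properties.Semiring.Divisibility semiring
  open Algebra.Properties.CommutativeSemigroup.Divisibility *-commutativeSemigroup
    using (x∣y⇒zx∣zy)
  open SetoidReasoning setoid

  unit-*-∣ : ∀ {u x y} → IsUnit R u → x ∣ y → u * x ∣ y
  unit-*-∣ {u} {x} {y} (u⁻¹ , u⁻¹u≈1 , _) (k , kx≈y) = k * u⁻¹ , (begin
    k * u⁻¹ * (u * x)    ≈⟨ *-assoc k u⁻¹ (u * x) ⟩
    k * (u⁻¹ * (u * x))  ≈⟨ *-congˡ (*-assoc u⁻¹ u x) ⟨
    k * (u⁻¹ * u * x)    ≈⟨ *-congˡ (*-congʳ u⁻¹u≈1) ⟩
    k * (1# * x)         ≈⟨ *-congˡ (*-identityˡ x) ⟩
    k * x                ≈⟨ kx≈y ⟩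
    y                    ∎)

  -- With `x = a * p`, primality of `q` forces `q ∣ a`; this replaces an appeal to coprimality.
  prime-*-∣ : ∀ {p q x} → Prime q → q ∤ p → p ∣ x → q ∣ x → p * q ∣ x
  prime-*-∣ {p} {q} {x} pq q∤p (a , ap≈x) q∣x
    with Prime.split-∣ pq (∣ʳ-respʳ-≈ (sym ap≈x) q∣x)
  ... | inj₁ q∣a = ∣ʳ-respʳ-≈ (trans (*-comm p a) ap≈x) (x∣y⇒zx∣zy p q∣a)
  ... | inj₂ q∣p = contradiction q∣p q∤p

-- Zero divisors modulo a product of two primes.

module QuotientByTwoPrimes (R : CommutativeRing c ℓ) {g p q : CommutativeRing.Carrier R} where
  open CommutativeRing R
  open Algebra.Definitions.RawSemiring (Semiring.rawSemiring semiring) using (Prime)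
  open Algebra.Properties.Semiring.Divisibility semiring
  open Algebra.Properties.CommutativeSemigroup.Divisibility *-commutativeSemigroup
    using (∙-cong-∣; x∣xy)
  open Algebra.Properties.AbelianGroup +-abelianGroup using (ε⁻¹≈ε)

  private
    Q = R / ⟨_⟩ R g
    module Q = CommutativeRing Q
    module Γ = SimpleGraph (Γ Q)
    module V = Setoid (nonzeroZeroDivisors Q)

    x-0≈x : ∀ x → x - 0# ≈ x
    x-0≈x x = trans (+-congˡ ε⁻¹≈ε) (+-identityʳ x)

    ∣⇒≈0 : ∀ {x} → g ∣ x → x Q.≈ 0#
    ∣⇒≈0 {x} = ∣ʳ-respʳ-≈ (sym (x-0≈x x))

    ≈0⇒∣ : ∀ {x} → x Q.≈ 0# → g ∣ x
    ≈0⇒∣ {x} = ∣ʳ-respʳ-≈ (x-0≈x x)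

  -- The hypotheses are symmetric in `p` and `q` up to commutativity, so the primes can be exchanged
  -- while `g`, and hence the quotient, stays fixed.
  module TwoPrimes (pp : Prime p) (pq : Prime q) (p∤q : p ∤ q) (q∤p : q ∤ p)
                   (g∣pq : g ∣ p * q) (pq∣g : p * q ∣ g) where

    private
      p∣g : p ∣ g
      p∣g = ∣ʳ-trans (x∣xy p q) pq∣g

      q∣g : q ∣ g
      q∣g = ∣ʳ-trans (x∣ʳyx q p) pq∣g

      p∣∧q∣⇒g∣ : ∀ {x} → p ∣ x → q ∣ x → g ∣ x
      p∣∧q∣⇒g∣ p∣x q∣x = ∣ʳ-trans g∣pq (prime-*-∣ R pq q∤p p∣x q∣x)

    -- The class of `p` is annihilated by that of `q`. Neither is zero: `g ∣ q` would give `p ∣ q`,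
    -- and `g ∣ p` would give `q ∣ p`.
    vertex : V.Carrier
    vertex = p , (q , (λ q≈0 → p∤q (∣ʳ-trans p∣g (≈0⇒∣ q≈0))) , ∣⇒≈0 g∣pq)
               , λ p≈0 → q∤p (∣ʳ-trans q∣g (≈0⇒∣ p≈0))

    p∣⊎q∣ : (v : V.Carrier) → p ∣ proj₁ v ⊎ q ∣ proj₁ v
    p∣⊎q∣ (r , (s , s≉0 , rs≈0) , _)
      with Prime.split-∣ pp (∣ʳ-trans p∣g (≈0⇒∣ rs≈0))
         | Prime.split-∣ pq (∣ʳ-trans q∣g (≈0⇒∣ rs≈0))
    ... | inj₁ p∣r | _        = inj₁ p∣r
    ... | inj₂ _   | inj₁ q∣r = inj₂ q∣r
    -- If both primes fall on the annihilator `s`, then `s` vanishes in the quotient.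
    ... | inj₂ p∣s | inj₂ q∣s = contradiction (∣⇒≈0 (p∣∧q∣⇒g∣ p∣s q∣s)) s≉0

    p∣∧q∣⇒*≈0 : ∀ {r s} → p ∣ r → q ∣ s → r * s Q.≈ 0#
    p∣∧q∣⇒*≈0 p∣r q∣s = ∣⇒≈0 (∣ʳ-trans g∣pq (∙-cong-∣ p∣r q∣s))

    -- A nonzero `u` divisible by `p` is not divisible by `q`, so `q` divides every neighbour `w` of
    -- `u`; then `w` also annihilates `v`.
    p∣⇒transfer : ∀ u v → p ∣ proj₁ u → p ∣ proj₁ v →
                  ∀ w → Γ.Adj u w → ¬ w V.≈ v → Γ.Adj v w
    p∣⇒transfer u@(_ , _ , r≉0) v p∣r p∣s w (_ , rt≈0) w≉v
      with Prime.split-∣ pq (∣ʳ-trans q∣g (≈0⇒∣ rt≈0))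
    ... | inj₁ q∣r = contradiction (∣⇒≈0 (p∣∧q∣⇒g∣ p∣r q∣r)) r≉0
    ... | inj₂ q∣t = (λ v≈w → w≉v (V.sym {v} {w} v≈w)) , p∣∧q∣⇒*≈0 p∣s q∣t

    p∣⇒∼′ : ∀ u v → p ∣ proj₁ u → p ∣ proj₁ v → _∼′_ (Γ Q) u v
    p∣⇒∼′ u v p∣r p∣s =
      ∼′-intro (Γ Q) {u} {v} (p∣⇒transfer u v p∣r p∣s) (p∣⇒transfer v u p∣s p∣r)

corollary75 : ∀ {c ℓ} (R : CommutativeRing c ℓ) →
  let open CommutativeRing R in
  IsPrincipalIdealDomain R →
  (g : Carrier) →
  let I = ⟨_⟩ R g
      Q = R / I in
  IsProper R I →
  ¬ IsPrimeIdeal R I →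
  Finite (CommutativeRing.setoid Q) →
  (u p₁ p₂ : Carrier) →
  IsUnit R u →
  IsPrimeElement R p₁ →
  IsPrimeElement R p₂ →
  ¬ Associated R p₁ p₂ →
  g ≈ u * (p₁ * p₂) →
  IsClique (Γ-E′ Q) × IsBoxicity (Γ-E′ Q) 0
corollary75 R isPID g _ _ finite u p₁ p₂ isUnit p₁-prime p₂-prime p₁≁p₂ g≈up₁p₂ =
  isClique , clique⇒boxicity≡0 (Γ-E′ Q) isClique
  where
  open CommutativeRing R
  open Algebra.Properties.Semiring.Divisibility semiring

  Q = R / ⟨_⟩ R g

  p₁∤p₂×p₂∤p₁ : p₁ ∤ p₂ × p₂ ∤ p₁
  p₁∤p₂×p₂∤p₁ =
    nonAssociated⇒∤ R (IsPrincipalIdealDomain.isIntegralDomain isPID) p₁-prime p₂-prime p₁≁p₂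

  g∣p₁p₂ : g ∣ p₁ * p₂
  g∣p₁p₂ = ∣ʳ-respˡ-≈ (sym g≈up₁p₂) (unit-*-∣ R isUnit ∣ʳ-refl)

  p₁p₂∣g : p₁ * p₂ ∣ g
  p₁p₂∣g = u , sym g≈up₁p₂

  open QuotientByTwoPrimes R
  module P₁ = TwoPrimes p₁-prime p₂-prime (proj₁ p₁∤p₂×p₂∤p₁) (proj₂ p₁∤p₂×p₂∤p₁)
                        g∣p₁p₂ p₁p₂∣g
  -- Exchanging the primes makes `p∣⇒∼′` available for pairs of vertices divisible by `p₂`.
  module P₂ = TwoPrimes p₂-prime p₁-prime (proj₂ p₁∤p₂×p₂∤p₁) (proj₁ p₁∤p₂×p₂∤p₁)
                        (∣ʳ-respʳ-≈ (*-comm p₁ p₂) g∣p₁p₂) (∣ʳ-respˡ-≈ (*-comm p₁ p₂) p₁p₂∣g)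

  ∼′⊎Adj : ∀ v w → ¬ Setoid._≈_ (nonzeroZeroDivisors Q) v w →
           _∼′_ (Γ Q) v w ⊎ SimpleGraph.Adj (Γ Q) v w
  ∼′⊎Adj v w v≉w with P₁.p∣⊎q∣ v | P₁.p∣⊎q∣ w
  ... | inj₁ p₁∣v | inj₁ p₁∣w = inj₁ (P₁.p∣⇒∼′ v w p₁∣v p₁∣w)
  ... | inj₂ p₂∣v | inj₂ p₂∣w = inj₁ (P₂.p∣⇒∼′ v w p₂∣v p₂∣w)
  ... | inj₁ p₁∣v | inj₂ p₂∣w = inj₂ (v≉w , P₁.p∣∧q∣⇒*≈0 p₁∣v p₂∣w)
  ... | inj₂ p₂∣v | inj₁ p₁∣w = inj₂ (v≉w , P₂.p∣∧q∣⇒*≈0 p₂∣v p₁∣w)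

  isClique : IsClique (Γ-E′ Q)
  isClique = quotientGraph-isClique (Γ Q)
    -- Vertices are compared through their underlying ring elements, so decidable equality on `Q`
    -- suffices.
    (λ v w → finite⇒decidable (CommutativeRing.setoid Q) finite (proj₁ v) (proj₁ w))
    P₁.vertex ∼′⊎Adj
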